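{- Let $K$ be a number field with algebraic closure $\overline{K}$, let $c\in K$, $c\neq 0$, and let $\mathcal{E}$ be the elliptic curve over $K$ with Weierstrass equation $y^2=x^3+c$. Let $\zeta_3,\zeta_5\in\overline{K}$ be primitive $3$-rd and $5$-th roots of unity respectively, and put $$\delta_1:=-\frac{(-132\zeta_3+24)\zeta_5^3+(36\zeta_3+108)\zeta_5^2+(-96\zeta_3-48)\zeta_5-48\zeta_3+116}{5}.$$ Then $$K_5=K\left(\sqrt[3]{\delta_1 c},\ \zeta_3,\ \sqrt{(\delta_1+1)c}\right).$$
   Context: $\mathcal{E}[5]$ denotes the $5$-torsion subgroup of $\mathcal{E}(\overline{K})$, and $K_5:=K(\mathcal{E}[5])$ is the field obtained by adjoining to $K$ the coordinates of all the points of $\mathcal{E}[5]$. The symbols $\sqrt[3]{\delta_1 c}$ and $\sqrt{(\delta_1+1)c}$ denote a fixed cube root and a fixed square root in $\overline{K}$. -}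

module Defs where

open import Level using (Level; _⊔_; suc)
open import Algebra.Apartness.Bundles using (HeytingField)
open import Algebra.Bundles using (CommutativeRing; RawMonoid; RawRing)
open import Algebra.Morphism.Structures using (module RingMorphisms)
open import Algebra.Solver.Ring.AlmostCommutativeRing
  using (AlmostCommutativeRing; fromCommutativeRing; _-Raw-AlmostCommutative⟶_)
import Algebra.Definitions.RawMonoid
import Algebra.Properties.Ring
import Algebra.Properties.Semiring.Exp
import Algebra.Properties.Semiring.Sum
import Algebra.Solver.Ring
import Relation.Binary.Reasoning.Setoid
open import Data.Empty.Polymorphic using (⊥)
open import Data.Fin using (Fin; toℕ)
open import Data.Integer as ℤ using (ℤ; +_)
open import Data.Maybe using (Maybe; just; nothing)
open import Data.Nat as ℕ using (ℕ)
open import Data.Product using (Σ; ∃; ∃-syntax; _×_; _,_; proj₁; proj₂)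
open import Data.Rational as ℚ using (ℚ)
open import Data.Sum using (_⊎_)
open import Data.Unit.Polymorphic using (⊤)
open import Function using (_∘_)
open import Relation.Binary using (Decidable; Rel)
open import Relation.Binary.PropositionalEquality as ≡ using (_≡_)
open import Relation.Nullary using (¬_; yes; no)
open import Relation.Unary using (Pred; _∈_)

-- Tightness and decidability make _#_ the same as "not equal", so classically
-- this is just a field (and 0# # 1# follows from invertible⇒#).

record Field c ℓ₁ ℓ₂ : Set (suc (c ⊔ ℓ₁ ⊔ ℓ₂)) where
  infix 4 _#?_
  field
    heytingField : HeytingField c ℓ₁ ℓ₂

  open HeytingField heytingField public

  field
    _#?_ : Decidable _#_

  commutativeRing : CommutativeRing c ℓ₁
  commutativeRing = record { isCommutativeRing = isCommutativeRing }

  open CommutativeRing commutativeRing public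
    using (rawRing; semiring; ring)
  open Algebra.Properties.Semiring.Exp semiring public using (_^_; ^-congˡ)
  open Algebra.Properties.Semiring.Sum semiring public using (sum)

  inverse : ∀ {x y} → x # y → Carrier
  inverse x#y = proj₁ (#⇒invertible x#y)

  -- The value at x of the monic polynomial Xⁿ + aₙ₋₁ Xⁿ⁻¹ + ⋯ + a₀.
  monic : ∀ {n} → (Fin n → Carrier) → Carrier → Carrier
  monic {n} a x = x ^ n + sum (λ i → a i * x ^ toℕ i)

  IsPrimitiveRoot : ℕ → Carrier → Set ℓ₁
  IsPrimitiveRoot n ζ = ζ ^ n ≈ 1# × (∀ m → 0 ℕ.< m → m ℕ.< n → ¬ ζ ^ m ≈ 1#)

IsRingHom : ∀ {a b c d} (A : RawRing a b) (B : RawRing c d) →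
            (RawRing.Carrier A → RawRing.Carrier B) → Set (a ⊔ b ⊔ d)
IsRingHom A B = RingMorphisms.IsRingHomomorphism A B

-- The homomorphism from ℚ gives characteristic zero; a finite spanning family,
-- not necessarily a basis, gives finite degree.

record NumberField c ℓ₁ ℓ₂ : Set (suc (c ⊔ ℓ₁ ⊔ ℓ₂)) where
  field
    asField : Field c ℓ₁ ℓ₂

  open Field asField public

  field
    fromℚ          : ℚ → Carrier
    fromℚ-isHom    : IsRingHom ℚ.+-*-rawRing rawRing fromℚ
    generatorCount : ℕ
    generator      : Fin generatorCount → Carrier
    spans          : ∀ x → Σ (Fin generatorCount → ℚ) λ q →
                     x ≈ sum (λ i → fromℚ (q i) * generator i)

-- Over a field, being a root of a nonzero polynomial and being a root of a monic
-- one are the same.  In algebraic, n = 0 would say 1# ≈ 0#, so n is positive.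

record AlgebraicClosure {c ℓ₁ ℓ₂} (K : Field c ℓ₁ ℓ₂) c′ ℓ₁′ ℓ₂′ :
       Set (c ⊔ ℓ₁ ⊔ ℓ₂ ⊔ suc (c′ ⊔ ℓ₁′ ⊔ ℓ₂′)) where
  private module K = Field K
  field
    asField : Field c′ ℓ₁′ ℓ₂′

  open Field asField public

  field
    ι                   : K.Carrier → Carrier
    ι-isHom             : IsRingHom K.rawRing rawRing ι
    algebraic           : ∀ x → ∃[ n ] Σ (Fin n → K.Carrier) λ a →
                          monic (ι ∘ a) x ≈ 0#
    algebraicallyClosed : ∀ {n} (a : Fin (ℕ.suc n) → Carrier) →
                          ∃[ x ] monic a x ≈ 0#

module OverNumberField
  {c ℓ₁ ℓ₂ c′ ℓ₁′ ℓ₂′} (K : NumberField c ℓ₁ ℓ₂)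
  (K̄ : AlgebraicClosure (NumberField.asField K) c′ ℓ₁′ ℓ₂′) where

  private module K = NumberField K
  open AlgebraicClosure K̄

  open import Data.List.Membership.Setoid setoid public
    using () renaming (_∈_ to _∈ₗ_)

  -- The subfield of K̄ generated by the image of K and by S.

  data K⟮_⟯ {s} (S : Pred Carrier s) : Pred Carrier (c ⊔ c′ ⊔ ℓ₁′ ⊔ s) where
    base : ∀ a → ι a ∈ K⟮ S ⟯
    gen  : ∀ {x} → x ∈ S → x ∈ K⟮ S ⟯
    add  : ∀ {x y} → x ∈ K⟮ S ⟯ → y ∈ K⟮ S ⟯ → x + y ∈ K⟮ S ⟯
    neg  : ∀ {x} → x ∈ K⟮ S ⟯ → - x ∈ K⟮ S ⟯
    mul  : ∀ {x y} → x ∈ K⟮ S ⟯ → y ∈ K⟮ S ⟯ → x * y ∈ K⟮ S ⟯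
    inv  : ∀ {x y} → x ∈ K⟮ S ⟯ → x * y ≈ 1# → y ∈ K⟮ S ⟯
    resp : ∀ {x y} → x ≈ y → x ∈ K⟮ S ⟯ → y ∈ K⟮ S ⟯

  rational : ℚ → Carrier
  rational q = ι (K.fromℚ q)

  integer : ℤ → Carrier
  integer n = rational (n ℚ./ 1)

  δ₁ : (ζ₃ ζ₅ : Carrier) → Carrier
  δ₁ ζ₃ ζ₅ = - (rational (+ 1 ℚ./ 5) *
    ( (integer (ℤ.- + 132) * ζ₃ + integer (+ 24)) * ζ₅ ^ 3
    + (integer (+ 36) * ζ₃ + integer (+ 108)) * ζ₅ ^ 2
    + (integer (ℤ.- + 96) * ζ₃ - integer (+ 48)) * ζ₅
    - integer (+ 48) * ζ₃
    + integer (+ 116)))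

  almostCommutativeRing : AlmostCommutativeRing c′ ℓ₁′
  almostCommutativeRing = fromCommutativeRing commutativeRing

  rationalCoefficients : ℚ.+-*-rawRing -Raw-AlmostCommutative⟶ almostCommutativeRing
  rationalCoefficients = record
    { ⟦_⟧    = rational
    ; +-homo = λ p q → trans (L.⟦⟧-cong (Q.+-homo p q)) (L.+-homo _ _)
    ; *-homo = λ p q → trans (L.⟦⟧-cong (Q.*-homo p q)) (L.*-homo _ _)
    ; -‿homo = λ p → trans (L.⟦⟧-cong (Q.-‿homo p)) (L.-‿homo _)
    ; 0-homo = trans (L.⟦⟧-cong Q.0#-homo) L.0#-homo
    ; 1-homo = trans (L.⟦⟧-cong Q.1#-homo) L.1#-homo
    }
    where
    module Q = RingMorphisms.IsRingHomomorphism K.fromℚ-isHom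
    module L = RingMorphisms.IsRingHomomorphism ι-isHom

  rational≟ : ∀ p q → Maybe (rational p ≈ rational q)
  rational≟ p q with p ℚ.≟ q
  ... | yes ≡.refl = just refl
  ... | no _       = nothing

  module Solver = Algebra.Solver.Ring ℚ.+-*-rawRing almostCommutativeRing
    rationalCoefficients rational≟

  module Curve (k : K.Carrier) where

    OnCurve : Carrier → Carrier → Set ℓ₁′
    OnCurve x y = y ^ 2 ≈ x ^ 3 + ι k

    data Point : Set (c′ ⊔ ℓ₁′) where
      𝒪      : Point
      affine : ∀ x y → OnCurve x y → Point

    infix 4 _≈ₚ_
    _≈ₚ_ : Rel Point ℓ₁′
    𝒪            ≈ₚ 𝒪              = ⊤
    𝒪            ≈ₚ affine _ _ _   = ⊥
    affine _ _ _ ≈ₚ 𝒪              = ⊥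
    affine x y _ ≈ₚ affine x′ y′ _ = x ≈ x′ × y ≈ y′

    -- The line of slope m through (x₁ , y₁), if it meets the curve again over
    -- x₂, meets it a third time over thirdX m x₁ x₂; thirdY is the y-coordinate
    -- of that third intersection after reflection in the x-axis.

    thirdX : (m x₁ x₂ : Carrier) → Carrier
    thirdX m x₁ x₂ = m ^ 2 - x₁ - x₂

    thirdY : (m x₁ x₂ y₁ : Carrier) → Carrier
    thirdY m x₁ x₂ y₁ = m * (x₁ - thirdX m x₁ x₂) - y₁

    chordSlope : ∀ {x₁ x₂} → x₁ # x₂ → (y₁ y₂ : Carrier) → Carrier
    chordSlope x₁#x₂ y₁ y₂ = (y₁ - y₂) * inverse x₁#x₂

    -- For y₁ ≈ y₂ this is 3x₁² / 2y₁.
    tangentSlope : ∀ {y₁ y₂} → Carrier → y₁ # - y₂ → Carrier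
    tangentSlope x₁ y₁#-y₂ = integer (+ 3) * x₁ ^ 2 * inverse y₁#-y₂

    private
      open Relation.Binary.Reasoning.Setoid setoid
      open Algebra.Properties.Ring ring using (x∙y⁻¹≈ε⇒x≈y; x≈y⇒x∙y⁻¹≈ε)
      open Solver using (solve; _:=_; _:+_; _:*_; _:-_; :-_; _:^_; con)

      cancel : ∀ {d e z} → e * d ≈ 1# → d * z ≈ 0# → z ≈ 0#
      cancel {d} {e} {z} ed dz = begin
        z           ≈⟨ *-identityˡ z ⟨
        1# * z      ≈⟨ *-congʳ ed ⟨
        e * d * z   ≈⟨ *-assoc e d z ⟩
        e * (d * z) ≈⟨ *-congˡ dz ⟩
        e * 0#      ≈⟨ zeroʳ e ⟩
        0#          ∎

      combine : ∀ {u v} a b → u ≈ 0# → v ≈ 0# → a * u + b * v ≈ 0#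
      combine a b u≈0 v≈0 = trans
        (+-cong (trans (*-congˡ u≈0) (zeroʳ a)) (trans (*-congˡ v≈0) (zeroʳ b)))
        (+-identityˡ 0#)

      x-y≈0⇒x≈y : ∀ {x y} → x - y ≈ 0# → x ≈ y
      x-y≈0⇒x≈y = x∙y⁻¹≈ε⇒x≈y _ _

      x≈y⇒x-y≈0 : ∀ {x y} → x ≈ y → x - y ≈ 0#
      x≈y⇒x-y≈0 = x≈y⇒x∙y⁻¹≈ε

      onCurve-cong : ∀ {x y x′ y′} → x ≈ x′ → y ≈ y′ → OnCurve x y → OnCurve x′ y′
      onCurve-cong x≈ y≈ p =
        trans (^-congˡ 2 (sym y≈)) (trans p (+-congʳ (^-congˡ 3 x≈)))

      divided : ∀ {d e} n → e * d ≈ 1# → n * e * d ≈ n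
      divided {d} {e} n ed =
        trans (*-assoc n e d) (trans (*-congˡ ed) (*-identityʳ n))

    abstract
      chord-onCurve : ∀ {x₁ y₁ x₂ y₂} (x₁#x₂ : x₁ # x₂) →
        OnCurve x₁ y₁ → OnCurve x₂ y₂ → let m = chordSlope x₁#x₂ y₁ y₂ in
        OnCurve (thirdX m x₁ x₂) (thirdY m x₁ x₂ y₁)
      chord-onCurve {x₁} {y₁} {x₂} {y₂} x₁#x₂ p₁ p₂ =
        x-y≈0⇒x≈y (cancel ed (trans
          (solve 5 (λ x₁ x₂ y₁ m k →
            let x₃ = m :^ 2 :- x₁ :- x₂
                y₃ = m :* (x₁ :- x₃) :- y₁
            in (x₁ :- x₂) :* (y₃ :^ 2 :- (x₃ :^ 3 :+ k))
               := (x₃ :- x₂) :* (y₁ :^ 2 :- (x₁ :^ 3 :+ k))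
               :+ (x₁ :- x₃) :* ((y₁ :- m :* (x₁ :- x₂)) :^ 2 :- (x₂ :^ 3 :+ k)))
            refl x₁ x₂ y₁ m (ι k))
          (combine _ _ (x≈y⇒x-y≈0 p₁) (x≈y⇒x-y≈0 p₂′))))
        where
        m : Carrier
        m = chordSlope x₁#x₂ y₁ y₂
        ed : inverse x₁#x₂ * (x₁ - x₂) ≈ 1#
        ed = proj₁ (proj₂ (#⇒invertible x₁#x₂))
        y₂-eq : y₁ - m * (x₁ - x₂) ≈ y₂
        y₂-eq = trans (+-congˡ (-‿cong (divided (y₁ - y₂) ed)))
          (solve 2 (λ y₁ y₂ → y₁ :- (y₁ :- y₂) := y₂) refl y₁ y₂)
        p₂′ : OnCurve x₂ (y₁ - m * (x₁ - x₂))
        p₂′ = onCurve-cong refl (sym y₂-eq) p₂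

      tangent-onCurve : ∀ {x₁ y₁ x₂ y₂} → x₁ ≈ x₂ → (y₁#-y₂ : y₁ # - y₂) →
        OnCurve x₁ y₁ → OnCurve x₂ y₂ → let m = tangentSlope x₁ y₁#-y₂ in
        OnCurve (thirdX m x₁ x₂) (thirdY m x₁ x₂ y₁)
      tangent-onCurve {x₁} {y₁} {x₂} {y₂} x₁≈x₂ y₁#-y₂ p₁ p₂ =
        onCurve-cong (+-congˡ (-‿cong x₁≈x₂))
          (+-congʳ (*-congˡ (+-congˡ (-‿cong (+-congˡ (-‿cong x₁≈x₂))))))
          (x-y≈0⇒x≈y (trans
            (solve 4 (λ x₁ y₁ m k →
              let x₃ = m :^ 2 :- x₁ :- x₁
                  y₃ = m :* (x₁ :- x₃) :- y₁
              in y₃ :^ 2 :- (x₃ :^ 3 :+ k)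
                 := con ℚ.1ℚ :* (y₁ :^ 2 :- (x₁ :^ 3 :+ k))
                 :+ (x₃ :- x₁) :* (m :* (y₁ :- :- y₁) :- con (+ 3 ℚ./ 1) :* x₁ :^ 2))
              refl x₁ y₁ m (ι k))
            (combine _ _ (x≈y⇒x-y≈0 p₁) (x≈y⇒x-y≈0 slope-eq))))
        where
        m : Carrier
        m = tangentSlope x₁ y₁#-y₂
        ed : inverse y₁#-y₂ * (y₁ - - y₂) ≈ 1#
        ed = proj₁ (proj₂ (#⇒invertible y₁#-y₂))
        y₁≈y₂ : y₁ ≈ y₂
        y₁≈y₂ = x-y≈0⇒x≈y (cancel ed (trans
          (solve 4 (λ x₁ y₁ y₂ k →
            (y₁ :- :- y₂) :* (y₁ :- y₂)
            := con ℚ.1ℚ :* (y₁ :^ 2 :- (x₁ :^ 3 :+ k))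
            :+ con (ℚ.- ℚ.1ℚ) :* (y₂ :^ 2 :- (x₁ :^ 3 :+ k)))
            refl x₁ y₁ y₂ (ι k))
          (combine _ _ (x≈y⇒x-y≈0 p₁)
            (x≈y⇒x-y≈0 (onCurve-cong (sym x₁≈x₂) refl p₂)))))
        slope-eq : m * (y₁ - - y₁) ≈ integer (+ 3) * x₁ ^ 2
        slope-eq = trans (*-congˡ (+-congˡ (-‿cong (-‿cong y₁≈y₂))))
          (divided _ ed)

    infixl 6 _+ₚ_
    _+ₚ_ : Point → Point → Point
    𝒪                +ₚ Q = Q
    P@(affine _ _ _) +ₚ 𝒪 = P
    affine x₁ y₁ p₁  +ₚ affine x₂ y₂ p₂ with x₁ #? x₂ | y₁ #? - y₂
    ... | yes x₁#x₂  | _          = affine _ _ (chord-onCurve x₁#x₂ p₁ p₂)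
    ... | no  ¬x₁#x₂ | yes y₁#-y₂ =
      affine _ _ (tangent-onCurve (proj₁ (tight _ _) ¬x₁#x₂) y₁#-y₂ p₁ p₂)
    ... | no  _      | no  _      = 𝒪

    rawMonoid : RawMonoid (c′ ⊔ ℓ₁′) ℓ₁′
    rawMonoid = record { _≈_ = _≈ₚ_ ; _∙_ = _+ₚ_ ; ε = 𝒪 }

    infixr 8 _·_
    _·_ : ℕ → Point → Point
    _·_ = Algebra.Definitions.RawMonoid._×_ rawMonoid

    E[_] : ℕ → Pred Point ℓ₁′
    E[ n ] P = n · P ≈ₚ 𝒪

    -- Coordinates are affine, so 𝒪 contributes none.

    _IsCoordinateOf_ : Carrier → Point → Set ℓ₁′
    z IsCoordinateOf 𝒪            = ⊥
    z IsCoordinateOf affine x y _ = z ≈ x ⊎ z ≈ y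

    K⟮E[_]⟯ : ℕ → Pred Carrier (c ⊔ c′ ⊔ ℓ₁′)
    K⟮E[ n ]⟯ = K⟮ (λ z → ∃[ P ] P ∈ E[ n ] × z IsCoordinateOf P) ⟯

-- A point (x , y) with x³ = t c and y² = (t + 1) c has order 5 exactly when t is a root
-- of a fixed quartic over ℚ, of which δ₁ is a root. So (r , s) and (ζ₃ r , s) have order
-- 5, and their x-coordinates have quotient ζ₃.
--
-- Conversely, the curve has complex multiplication by √-3 = 2ζ₃ + 1. Multiplication by √-3
-- is defined over K(ζ₃), preserves the points of order 5, and induces a permutation of the
-- roots of the quartic, which is transitive because √-3 generates 𝔽₂₅ˣ modulo the units of
-- ℤ[ζ₃]. Starting from (r , s), it gives for each root t a point over K(r, ζ₃, s), and any
-- other point with the same t differs from it by a cube root of unity in x and a sign in y.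
module Submission where

open import Defs
import Algebra.Apartness.Properties.HeytingCommutativeRing
import Algebra.Properties.Ring
import Algebra.Solver.Ring.AlmostCommutativeRing
open import Algebra.Apartness.Bundles using (HeytingField)
open import Algebra.Morphism.Structures using (module RingMorphisms)
open import Data.Empty using (⊥-elim)
open import Data.Integer as ℤ using (+_)
open import Data.List using (_∷_; [])
open import Data.List.Relation.Unary.Any using (here; there)
open import Data.Nat using (ℕ; z<s; s<s)
open import Data.Product using (∃-syntax; _×_; _,_; proj₁; proj₂)
import Data.Rational as ℚ
open import Data.Sum as Sum using (_⊎_; inj₁; inj₂; [_,_]′)
open import Data.Unit.Polymorphic using (tt)
open import Level using (_⊔_)
open import Relation.Nullary using (¬_; yes; no)
open import Relation.Unary using (Pred; _∈_; _⊆_; _≐_)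

module FiveDivision {c ℓ₁ ℓ₂ c′ ℓ₁′ ℓ₂′} (K : NumberField c ℓ₁ ℓ₂)
  (K̄ : AlgebraicClosure (NumberField.asField K) c′ ℓ₁′ ℓ₂′) where

  private module K = NumberField K
  open AlgebraicClosure K̄
  open OverNumberField K K̄
  open Solver using (Polynomial; solve; _:=_; _:+_; _:*_; _:-_; :-_; _:^_; con)
  open Algebra.Properties.Ring ring using (x∙y⁻¹≈ε⇒x≈y; x≈y⇒x∙y⁻¹≈ε)
  open Algebra.Apartness.Properties.HeytingCommutativeRing
    (HeytingField.heytingCommutativeRing heytingField) using (1#0; x-0≈x)

  -- Arithmetic in the algebraic closure: nonvanishing, cancellation, proofs by ring identities.

  infix 4 _≉_
  _≉_ : Carrier → Carrier → Set ℓ₁′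
  x ≉ y = ¬ x ≈ y

  #⇒≉ : ∀ {x y} → x # y → x ≉ y
  #⇒≉ x#y x≈y = proj₂ (tight _ _) x≈y x#y

  ¬#⇒≈ : ∀ {x y} → ¬ x # y → x ≈ y
  ¬#⇒≈ = proj₁ (tight _ _)

  1≉0 : 1# ≉ 0#
  1≉0 = #⇒≉ 1#0

  reciprocal : ∀ {x} → x ≉ 0# → ∃[ y ] x * y ≈ 1#
  reciprocal {x} x≉0 with x #? 0#
  ... | no  ¬x#0 = ⊥-elim (x≉0 (¬#⇒≈ ¬x#0))
  ... | yes x#0  with #⇒invertible x#0
  ...   | y , _ , xy≈1 = y , trans (*-congʳ (sym (x-0≈x x))) xy≈1

  difference : ∀ {x y} → x ≈ y → x - y ≈ 0#
  difference = x≈y⇒x∙y⁻¹≈ε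

  equal : ∀ {x y} → x - y ≈ 0# → x ≈ y
  equal = x∙y⁻¹≈ε⇒x≈y _ _

  -- A ring identity x - y = ∑ᵢ aᵢ (uᵢ - vᵢ) turns the equations uᵢ ≈ vᵢ into x ≈ y.
  infixl 6 _⊹_
  _⊹_ : ∀ {x y} → x ≈ 0# → y ≈ 0# → x + y ≈ 0#
  p ⊹ q = trans (+-cong p q) (+-identityˡ 0#)

  infix 7 ∙_ ·_
  ∙_ : ∀ {a u} → u ≈ 0# → a * u ≈ 0#
  ∙_ {a} p = trans (*-congˡ p) (zeroʳ a)

  ·_ : ∀ {a u v} → u ≈ v → a * (u - v) ≈ 0#
  · p = ∙ difference p

  by : ∀ {x y z} → x - y ≈ z → z ≈ 0# → x ≈ y
  by identity p = equal (trans identity p)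

  cancelˡ : ∀ {x y} → x ≉ 0# → x * y ≈ 0# → y ≈ 0#
  cancelˡ {x} {y} x≉0 xy≈0 with reciprocal x≉0
  ... | x⁻¹ , xx⁻¹≈1 = trans (sym (*-identityˡ y)) (trans (*-congʳ (sym xx⁻¹≈1))
    (trans (solve 3 (λ x y x⁻¹ → x :* x⁻¹ :* y := x⁻¹ :* (x :* y)) refl x y x⁻¹) (∙ xy≈0)))

  zeroProduct : ∀ {x y} → x * y ≈ 0# → x ≈ 0# ⊎ y ≈ 0#
  zeroProduct {x} {y} xy≈0 with x #? 0#
  ... | yes x#0 = inj₂ (cancelˡ (#⇒≉ x#0) xy≈0)
  ... | no ¬x#0 = inj₁ (¬#⇒≈ ¬x#0)

  one : integer (+ 1) ≈ 1#
  one = 1-homo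
    where open Algebra.Solver.Ring.AlmostCommutativeRing._-Raw-AlmostCommutative⟶_ rationalCoefficients

  integer1≉0 : integer (+ 1) ≉ 0#
  integer1≉0 p = 1≉0 (trans (sym one) p)

  -- The quartic of the 5-torsion points and the action of √-3 on its roots.

  ⟨_⟩ : ∀ {n} → ℕ → Polynomial n
  ⟨ m ⟩ = con (+ m ℚ./ 1)

  -- The fifth division polynomial is c⁴ quartic (x³ / c).
  quartic : Carrier → Carrier
  quartic t = integer (+ 5) * t ^ 4 + integer (+ 380) * t ^ 3 - integer (+ 240) * t ^ 2
    - integer (+ 1600) * t - integer (+ 256)

  -- A name that begins with a colon is the solver's expression for the operation
  -- without the colon.
  :quartic : ∀ {n} → Polynomial n → Polynomial n
  :quartic t = ⟨ 5 ⟩ :* t :^ 4 :+ ⟨ 380 ⟩ :* t :^ 3 :- ⟨ 240 ⟩ :* t :^ 2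
    :- ⟨ 1600 ⟩ :* t :- ⟨ 256 ⟩

  quartic⇒≉0 : ∀ {t} → quartic t ≈ 0# → t ≉ 0#
  quartic⇒≉0 {t} f t≈0 = integer1≉0 (trans
    (solve 1 (λ t → ⟨ 1 ⟩ := con (ℤ.- + 1 ℚ./ 256) :* :quartic t
      :+ con (+ 1 ℚ./ 256) :* (⟨ 5 ⟩ :* t :^ 3 :+ ⟨ 380 ⟩ :* t :^ 2 :- ⟨ 240 ⟩ :* t :- ⟨ 1600 ⟩) :* t)
      refl t)
    (∙ f ⊹ ∙ t≈0))

  -- The value of `quartic` at -1 is 729, so t = -1 would give 729 = 0. Since y² = (t + 1) c, roots
  -- of `quartic` belong to points with y ≠ 0.
  quartic⇒+1≉0 : ∀ {t} → quartic t ≈ 0# → t + integer (+ 1) ≉ 0#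
  quartic⇒+1≉0 {t} f t+1≈0 = integer1≉0 (trans
    (solve 1 (λ t → ⟨ 1 ⟩ := con (+ 1 ℚ./ 729) :* :quartic t
      :+ con (ℤ.- + 1 ℚ./ 729) :* (⟨ 5 ⟩ :* t :^ 3 :+ ⟨ 375 ⟩ :* t :^ 2 :- ⟨ 615 ⟩ :* t :- ⟨ 985 ⟩)
        :* (t :+ ⟨ 1 ⟩))
      refl t)
    (∙ f ⊹ ∙ t+1≈0))

  -- Over ℚ(√5), quartic is the product of conic q and conic (- q), up to a constant,
  -- where q² = 5.
  conic : (q t : Carrier) → Carrier
  conic q t = integer (+ 5) * t ^ 2 + (integer (+ 190) - integer (+ 90) * q) * t
    + integer (+ 320) - integer (+ 144) * q

  :conic : ∀ {n} (q t : Polynomial n) → Polynomial n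
  :conic q t = ⟨ 5 ⟩ :* t :^ 2 :+ (⟨ 190 ⟩ :- ⟨ 90 ⟩ :* q) :* t
    :+ ⟨ 320 ⟩ :- ⟨ 144 ⟩ :* q

  _√5 : Carrier → Set ℓ₁′
  q √5 = q ^ 2 ≈ integer (+ 5)

  -√5 : ∀ {q} → q √5 → (- q) √5
  -√5 {q} h = trans (solve 1 (λ q → (:- q) :^ 2 := q :^ 2) refl q) h

  quartic-factors : ∀ {q} t → q √5 → conic q t * conic (- q) t ≈ integer (+ 5) * quartic t
  quartic-factors {q} t h = by
    (solve 2 (λ q t → :conic q t :* :conic (:- q) t :- ⟨ 5 ⟩ :* :quartic t
      := (:- (⟨ 90 ⟩ :* t :+ ⟨ 144 ⟩) :^ 2) :* (q :^ 2 :- ⟨ 5 ⟩))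
      refl q t)
    (· h)

  -- The root t of quartic that belongs to P is sent to the one that belongs to √-3 P.
  next : (q t : Carrier) → Carrier
  next q t = rational (+ 1 ℚ./ 2) * (integer (+ 29) + integer (+ 13) * q) * t
    - integer (+ 36) - integer (+ 16) * q

  :next : ∀ {n} (q t : Polynomial n) → Polynomial n
  :next q t = con (+ 1 ℚ./ 2) :* (⟨ 29 ⟩ :+ ⟨ 13 ⟩ :* q) :* t
    :- ⟨ 36 ⟩ :- ⟨ 16 ⟩ :* q

  next-conic : ∀ {q t} → q √5 → conic q t ≈ 0# → conic (- q) (next q t) ≈ 0#
  next-conic {q} {t} h p = trans
    (solve 2 (λ q t → :conic (:- q) (:next q t)
      := (con (+ 169 ℚ./ 4) :* q :^ 2 :+ con (+ 377 ℚ./ 2) :* q :+ con (+ 841 ℚ./ 4)) :* :conic q t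
      :+ (con (+ 7605 ℚ./ 2) :* t :* q :+ con (+ 16965 ℚ./ 2) :* t :+ ⟨ 6084 ⟩ :* q :+ ⟨ 13464 ⟩)
        :* (q :^ 2 :- ⟨ 5 ⟩))
      refl q t)
    (∙ p ⊹ · h)

  -- On t = x³ / c, multiplication by √-3 is the rational map t ↦ -(t + 4)³ / (27 t²). Modulo
  -- `conic q` it reduces to the linear expression `next q t`.
  next-isogeny : ∀ {q t} → q √5 → conic q t ≈ 0# →
    integer (+ 27) * t ^ 2 * next q t ≈ - (t + integer (+ 4)) ^ 3
  next-isogeny {q} {t} h p = by
    (solve 2 (λ q t → ⟨ 27 ⟩ :* t :^ 2 :* :next q t :- :- (t :+ ⟨ 4 ⟩) :^ 3
      := (con (+ 351 ℚ./ 10) :* t :* q :+ con (+ 157 ℚ./ 2) :* t :+ con (+ 3159 ℚ./ 5) :* q :^ 2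
          :- con (+ 36 ℚ./ 5) :* q :- ⟨ 3175 ⟩) :* :conic q t
      :+ (⟨ 56862 ⟩ :* t :* q :- con (+ 578178 ℚ./ 5) :* t :+ con (+ 454896 ℚ./ 5) :* q
          :- con (+ 1016064 ℚ./ 5)) :* (q :^ 2 :- ⟨ 5 ⟩))
      refl q t)
    (∙ p ⊹ · h)

  -- The roots of `conic q` add up to 18 q - 38, so for a root `t` the right side is the other root.
  next-next : ∀ {q} t → q √5 → next (- q) (next q t) ≈ integer (+ 18) * q - integer (+ 38) - t
  next-next {q} t h = by
    (solve 2 (λ q t → :next (:- q) (:next q t) :- (⟨ 18 ⟩ :* q :- ⟨ 38 ⟩ :- t)
      := (⟨ 104 ⟩ :- con (+ 169 ℚ./ 4) :* t) :* (q :^ 2 :- ⟨ 5 ⟩))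
      refl q t)
    (· h)

  conic-roots : ∀ {q t T} → q √5 → conic q t ≈ 0# → conic q T ≈ 0# →
    T ≈ t ⊎ T ≈ next (- q) (next q t)
  conic-roots {q} {t} {T} h p P =
    Sum.map equal (λ T≈t′ → trans (equal T≈t′) (sym (next-next t h)))
      (zeroProduct (trans
        (solve 3 (λ q t T → (T :- t) :* (T :- (⟨ 18 ⟩ :* q :- ⟨ 38 ⟩ :- t))
          := con (+ 1 ℚ./ 5) :* :conic q T :+ con (ℤ.- + 1 ℚ./ 5) :* :conic q t)
          refl q t T)
        (∙ P ⊹ ∙ p)))

  -- Cyclotomic relations, √5 in terms of ζ₅, and `δ₁` as a root of the quartic.

  √5-expression : Carrier → Carrier
  √5-expression z = - integer (+ 1) - integer (+ 2) * z ^ 2 - integer (+ 2) * z ^ 3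

  :√5-expression : ∀ {n} → Polynomial n → Polynomial n
  :√5-expression z = :- ⟨ 1 ⟩ :- ⟨ 2 ⟩ :* z :^ 2 :- ⟨ 2 ⟩ :* z :^ 3

  cyclotomic₃ : ∀ {w} → IsPrimitiveRoot 3 w → w ^ 2 + w + integer (+ 1) ≈ 0#
  cyclotomic₃ {w} (w³≈1 , minimal) = cancelˡ {w - integer (+ 1)}
    (λ w-1≈0 → minimal 1 z<s (s<s z<s) (trans (*-identityʳ w) (trans (equal w-1≈0) one)))
    (trans
      (solve 1 (λ w → (w :- ⟨ 1 ⟩) :* (w :^ 2 :+ w :+ ⟨ 1 ⟩) := w :^ 3 :- ⟨ 1 ⟩) refl w)
      (difference (trans w³≈1 (sym one))))

  cyclotomic₅ : ∀ {z} → IsPrimitiveRoot 5 z → z ^ 4 + z ^ 3 + z ^ 2 + z + integer (+ 1) ≈ 0#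
  cyclotomic₅ {z} (z⁵≈1 , minimal) = cancelˡ {z - integer (+ 1)}
    (λ z-1≈0 → minimal 1 z<s (s<s z<s) (trans (*-identityʳ z) (trans (equal z-1≈0) one)))
    (trans
      (solve 1 (λ z → (z :- ⟨ 1 ⟩) :* (z :^ 4 :+ z :^ 3 :+ z :^ 2 :+ z :+ ⟨ 1 ⟩) := z :^ 5 :- ⟨ 1 ⟩) refl z)
      (difference (trans z⁵≈1 (sym one))))

  -- The quadratic Gauss sum z - z² - z³ + z⁴ has square 5; `√5-expression` is this sum with z⁴
  -- eliminated by the cyclotomic relation.
  √5-expression-√5 : ∀ {z} → IsPrimitiveRoot 5 z → √5-expression z √5
  √5-expression-√5 {z} h = by
    (solve 1 (λ z → :√5-expression z :^ 2 :- ⟨ 5 ⟩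
      := (⟨ 4 ⟩ :* z :^ 2 :+ ⟨ 4 ⟩ :* z :- ⟨ 4 ⟩) :* (z :^ 4 :+ z :^ 3 :+ z :^ 2 :+ z :+ ⟨ 1 ⟩))
      refl z)
    (∙ cyclotomic₅ h)

  :δ₁ : ∀ {n} (w z : Polynomial n) → Polynomial n
  :δ₁ w z = :- (con (+ 1 ℚ./ 5) :*
    ( (con (ℤ.- + 132 ℚ./ 1) :* w :+ ⟨ 24 ⟩) :* z :^ 3
    :+ (⟨ 36 ⟩ :* w :+ ⟨ 108 ⟩) :* z :^ 2
    :+ (con (ℤ.- + 96 ℚ./ 1) :* w :- ⟨ 48 ⟩) :* z
    :- ⟨ 48 ⟩ :* w
    :+ ⟨ 116 ⟩))

  -- Division by w² + w + 1 in `w` leaves a polynomial in `z` alone, which is a multiple of the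
  -- fifth cyclotomic polynomial.
  δ₁-conic : ∀ {w z} → IsPrimitiveRoot 3 w → IsPrimitiveRoot 5 z →
    conic (√5-expression z) (δ₁ w z) ≈ 0#
  δ₁-conic {w} {z} h₃ h₅ = trans
    (solve 2 (λ w z → :conic (:√5-expression z) (:δ₁ w z)
      := (con (+ 17424 ℚ./ 5) :* z :^ 6 :- con (+ 9504 ℚ./ 5) :* z :^ 5 :+ ⟨ 5328 ⟩ :* z :^ 4
          :+ ⟨ 1152 ⟩ :* z :^ 3 :+ ⟨ 1152 ⟩ :* z :^ 2 :+ con (+ 9216 ℚ./ 5) :* z :+ con (+ 2304 ℚ./ 5))
        :* (w :^ 2 :+ w :+ ⟨ 1 ⟩)
      :+ (con (ℤ.- + 21168 ℚ./ 5) :* z :^ 2 :+ con (+ 12096 ℚ./ 5) :* z :- con (+ 19008 ℚ./ 5))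
        :* (z :^ 4 :+ z :^ 3 :+ z :^ 2 :+ z :+ ⟨ 1 ⟩))
      refl w z)
    (∙ cyclotomic₃ h₃ ⊹ ∙ cyclotomic₅ h₅)

  -- The condition 5P = 𝒪 in terms of slopes.

  halve : ∀ {x} → integer (+ 2) * x ≈ 0# → x ≈ 0#
  halve {x} 2x≈0 = trans (solve 1 (λ x → x := con (+ 1 ℚ./ 2) :* (⟨ 2 ⟩ :* x)) refl x) (∙ 2x≈0)

  self-opposite : ∀ {y} → y ≈ - y → y ≈ 0#
  self-opposite {y} y≈-y = halve (trans
    (solve 1 (λ y → ⟨ 2 ⟩ :* y := ⟨ 1 ⟩ :* (y :- :- y)) refl y) (· y≈-y))

  -- For P = (x , y), the slopes m₁, m₂, m₃ of the lines through P, P, through P, 2P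
  -- and through P, 3P satisfy symmetric equations in u = x - x(2P) and v = x - x(3P).
  -- They make 5P = 𝒪 equivalent to u = v, that is, to tripled x y u ≈ 0.
  tripled : (x y u : Carrier) → Carrier
  tripled x y u = u ^ 3 + integer (+ 4) * y ^ 2 - integer (+ 6) * x ^ 2 * u

  :tripled : ∀ {n} (x y u : Polynomial n) → Polynomial n
  :tripled x y u = u :^ 3 :+ ⟨ 4 ⟩ :* y :^ 2 :- ⟨ 6 ⟩ :* x :^ 2 :* u

  -- At u = 0 the value of `tripled` is 4 y².
  tripled⇒u≉0 : ∀ {x y u} → y ≉ 0# → tripled x y u ≈ 0# → u ≉ 0#
  tripled⇒u≉0 {x} {y} {u} y≉0 W u≈0 = y≉0 (cancelˡ y≉0 (trans
    (solve 3 (λ x y u → y :* y := con (+ 1 ℚ./ 4) :* :tripled x y u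
      :+ con (ℤ.- + 1 ℚ./ 4) :* (u :^ 2 :- ⟨ 6 ⟩ :* x :^ 2) :* u) refl x y u)
    (∙ W ⊹ ∙ u≈0)))

  -- `M` and `U` describe the tangent at P, `V` the chord through P and 2P. `H₂` holds because 2P
  -- has y-coordinate m₁ u - y, while m₂ u is y minus that coordinate.
  module Slopes {x y m₁ m₂ u v : Carrier} (y≉0 : y ≉ 0#)
    (M : m₁ * (integer (+ 2) * y) ≈ integer (+ 3) * x ^ 2)
    (U : u ≈ integer (+ 3) * x - m₁ ^ 2)
    (V : v ≈ integer (+ 3) * x - u - m₂ ^ 2)
    (H₂ : (m₁ + m₂) * u ≈ integer (+ 2) * y) where

    -- By `U` and `V`, u - v = u - (m₁ - m₂) (m₁ + m₂). After multiplication by u², the slopes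
    -- disappear through (m₁ + m₂) u = 2 y and 2 y m₁ = 3 x².
    tripled-identity : tripled x y u - u ^ 2 * (u - v) ≈ 0#
    tripled-identity = trans
      (solve 6 (λ x y m₁ m₂ u v → :tripled x y u :- u :^ 2 :* (u :- v)
        := u :^ 2 :* (v :- (⟨ 3 ⟩ :* x :- u :- m₂ :^ 2))
        :+ (:- u :^ 2) :* (u :- (⟨ 3 ⟩ :* x :- m₁ :^ 2))
        :+ (u :* (m₁ :- m₂) :- ⟨ 2 ⟩ :* y) :* ((m₁ :+ m₂) :* u :- ⟨ 2 ⟩ :* y)
        :+ ⟨ 2 ⟩ :* u :* (m₁ :* (⟨ 2 ⟩ :* y) :- ⟨ 3 ⟩ :* x :^ 2))
        refl x y m₁ m₂ u v)
      (· V ⊹ · U ⊹ · H₂ ⊹ · M)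

    u≈v⇒tripled : u ≈ v → tripled x y u ≈ 0#
    u≈v⇒tripled u≈v = trans (equal tripled-identity) (∙ difference u≈v)

    tripled⇒u≈v : tripled x y u ≈ 0# → u ≈ v
    tripled⇒u≈v W = equal (cancelˡ u≉0 (cancelˡ u≉0 (trans
      (solve 4 (λ x y u v → u :* (u :* (u :- v))
        := ⟨ 1 ⟩ :* :tripled x y u :+ (:- ⟨ 1 ⟩) :* (:tripled x y u :- u :^ 2 :* (u :- v))) refl x y u v)
      (∙ W ⊹ ∙ tripled-identity))))
      where
      u≉0 : u ≉ 0#
      u≉0 = tripled⇒u≉0 y≉0 W

    -- The second hypothesis says that 4P lies over x. It forces m₃ = m₁, and then (m₁ + m₂) u = 2 y
    -- = (m₁ + m₂) v with m₁ + m₂ ≠ 0.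
    fourfold⇒tripled : ∀ {m₃} → (m₂ + m₃) * v ≈ integer (+ 2) * y → m₃ ^ 2 ≈ integer (+ 3) * x - v →
      tripled x y u ≈ 0#
    fourfold⇒tripled {m₃} H₃ M₃ = u≈v⇒tripled (equal (cancelˡ m₁+m₂≉0 (trans
      (solve 6 (λ y m₁ m₂ m₃ u v → (m₁ :+ m₂) :* (u :- v)
        := ⟨ 1 ⟩ :* ((m₁ :+ m₂) :* u :- ⟨ 2 ⟩ :* y)
        :+ (:- ⟨ 1 ⟩) :* ((m₂ :+ m₃) :* v :- ⟨ 2 ⟩ :* y) :+ v :* (m₃ :- m₁))
        refl y m₁ m₂ m₃ u v)
      (· H₂ ⊹ · H₃ ⊹ ∙ m₃-m₁≈0))))
      where
      m₁+m₂≉0 : m₁ + m₂ ≉ 0#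
      m₁+m₂≉0 p = y≉0 (halve (trans
        (solve 4 (λ y m₁ m₂ u → ⟨ 2 ⟩ :* y := u :* (m₁ :+ m₂) :+ (:- ⟨ 1 ⟩) :* ((m₁ :+ m₂) :* u :- ⟨ 2 ⟩ :* y))
          refl y m₁ m₂ u)
        (∙ p ⊹ · H₂)))
      m₃-m₁≈0 : m₃ - m₁ ≈ 0#
      -- Here m₃² - m₂² = u and m₁² - m₂² = v, so 2 y (m₃ - m₂) and 2 y (m₁ - m₂) are both u v.
      m₃-m₁≈0 = cancelˡ y≉0 (halve (trans
        (solve 7 (λ x y m₁ m₂ m₃ u v → ⟨ 2 ⟩ :* (y :* (m₃ :- m₁))
          := (:- (m₃ :- m₂)) :* ((m₂ :+ m₃) :* v :- ⟨ 2 ⟩ :* y)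
          :+ (m₁ :- m₂) :* ((m₁ :+ m₂) :* u :- ⟨ 2 ⟩ :* y)
          :+ v :* (m₃ :^ 2 :- (⟨ 3 ⟩ :* x :- v))
          :+ (u :- v) :* (v :- (⟨ 3 ⟩ :* x :- u :- m₂ :^ 2))
          :+ (:- u) :* (u :- (⟨ 3 ⟩ :* x :- m₁ :^ 2)))
          refl x y m₁ m₂ m₃ u v)
        (· H₃ ⊹ · H₂ ⊹ · M₃ ⊹ · V ⊹ · U)))

    tripled⇒fourfold : ∀ {m₃} → (m₂ + m₃) * v ≈ integer (+ 2) * y → tripled x y u ≈ 0# →
      m₃ ^ 2 ≈ integer (+ 3) * x - v
    tripled⇒fourfold {m₃} H₃ W = by
      (solve 5 (λ x m₁ m₃ u v → m₃ :^ 2 :- (⟨ 3 ⟩ :* x :- v)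
        := (m₃ :+ m₁) :* (m₃ :- m₁) :+ (:- ⟨ 1 ⟩) :* (u :- v) :+ ⟨ 1 ⟩ :* (u :- (⟨ 3 ⟩ :* x :- m₁ :^ 2)))
        refl x m₁ m₃ u v)
      (∙ m₃-m₁≈0 ⊹ · u≈v ⊹ · U)
      where
      u≈v : u ≈ v
      u≈v = tripled⇒u≈v W
      m₃-m₁≈0 : m₃ - m₁ ≈ 0#
      m₃-m₁≈0 = cancelˡ (tripled⇒u≉0 y≉0 W) (trans
        (solve 6 (λ y m₁ m₂ m₃ u v → u :* (m₃ :- m₁)
          := ⟨ 1 ⟩ :* ((m₂ :+ m₃) :* v :- ⟨ 2 ⟩ :* y)
          :+ (:- ⟨ 1 ⟩) :* ((m₁ :+ m₂) :* u :- ⟨ 2 ⟩ :* y) :+ (m₂ :+ m₃) :* (u :- v))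
          refl y m₁ m₂ m₃ u v)
        (· H₃ ⊹ · H₂ ⊹ · u≈v))

  -- From slopes to the quartic in t = x³ / c.

  module Scaled {c x y t m u : Carrier} (c≉0 : c ≉ 0#)
    (X : x ^ 3 ≈ t * c) (Y : y ^ 2 ≈ (t + integer (+ 1)) * c)
    (M : m * (integer (+ 2) * y) ≈ integer (+ 3) * x ^ 2)
    (U : u ≈ integer (+ 3) * x - m ^ 2) where

    -- The tangent slope satisfies m² = 9 x⁴ / (4 y²) = 9 t x / (4 (t + 1)), which is subtracted
    -- from 3 x.
    u-equation : integer (+ 4) * (t + integer (+ 1)) * u ≈ integer (+ 3) * x * (t + integer (+ 4))
    u-equation = equal (cancelˡ c≉0 (trans
      (solve 6 (λ c x y t m u → c :* (⟨ 4 ⟩ :* (t :+ ⟨ 1 ⟩) :* u :- ⟨ 3 ⟩ :* x :* (t :+ ⟨ 4 ⟩))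
        := (⟨ 12 ⟩ :* x :- ⟨ 4 ⟩ :* u) :* (y :^ 2 :- (t :+ ⟨ 1 ⟩) :* c)
        :+ ⟨ 4 ⟩ :* y :^ 2 :* (u :- (⟨ 3 ⟩ :* x :- m :^ 2))
        :+ (:- (m :* (⟨ 2 ⟩ :* y) :+ ⟨ 3 ⟩ :* x :^ 2)) :* (m :* (⟨ 2 ⟩ :* y) :- ⟨ 3 ⟩ :* x :^ 2)
        :+ (:- ⟨ 9 ⟩ :* x) :* (x :^ 3 :- t :* c))
        refl c x y t m u)
      (· Y ⊹ · U ⊹ · M ⊹ · X)))

    -- Substituting u = 3 x (t + 4) / (4 (t + 1)) leaves only x³ and y², hence c times 27 t (t + 4)³
    -- - 288 t (t + 1)² (t + 4) + 256 (t + 1)⁴, which is `- quartic t`.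
    tripled-quartic : integer (+ 64) * (t + integer (+ 1)) ^ 3 * tripled x y u + c * quartic t ≈ 0#
    tripled-quartic = trans
      (solve 5 (λ c x y t u →
        ⟨ 64 ⟩ :* (t :+ ⟨ 1 ⟩) :^ 3 :* :tripled x y u :+ c :* :quartic t
        := (⟨ 16 ⟩ :* (t :+ ⟨ 1 ⟩) :^ 2 :* u :^ 2 :+ ⟨ 12 ⟩ :* (t :+ ⟨ 1 ⟩) :* u :* x :* (t :+ ⟨ 4 ⟩)
            :+ ⟨ 9 ⟩ :* x :^ 2 :* (t :+ ⟨ 4 ⟩) :^ 2 :- ⟨ 96 ⟩ :* (t :+ ⟨ 1 ⟩) :^ 2 :* x :^ 2)
          :* (⟨ 4 ⟩ :* (t :+ ⟨ 1 ⟩) :* u :- ⟨ 3 ⟩ :* x :* (t :+ ⟨ 4 ⟩))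
        :+ (⟨ 27 ⟩ :* (t :+ ⟨ 4 ⟩) :^ 3 :- ⟨ 288 ⟩ :* (t :+ ⟨ 1 ⟩) :^ 2 :* (t :+ ⟨ 4 ⟩)) :* (x :^ 3 :- t :* c)
        :+ ⟨ 256 ⟩ :* (t :+ ⟨ 1 ⟩) :^ 3 :* (y :^ 2 :- (t :+ ⟨ 1 ⟩) :* c))
        refl c x y t u)
      (· u-equation ⊹ · X ⊹ · Y)

    tripled⇒quartic : tripled x y u ≈ 0# → quartic t ≈ 0#
    tripled⇒quartic W = cancelˡ c≉0 (trans
      (solve 3 (λ a W cf → cf := ⟨ 1 ⟩ :* (a :* W :+ cf) :+ (:- a) :* W)
        refl (integer (+ 64) * (t + integer (+ 1)) ^ 3) (tripled x y u) (c * quartic t))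
      (∙ tripled-quartic ⊹ ∙ W))

    quartic⇒tripled : quartic t ≈ 0# → tripled x y u ≈ 0#
    quartic⇒tripled f = cancelˡ s≉0 (cancelˡ s≉0 (cancelˡ s≉0 (trans
      (solve 4 (λ s W c f → s :* (s :* (s :* W))
        := con (+ 1 ℚ./ 64) :* (⟨ 64 ⟩ :* s :^ 3 :* W :+ c :* f) :+ con (ℤ.- + 1 ℚ./ 64) :* c :* f)
        refl (t + integer (+ 1)) (tripled x y u) c (quartic t))
      (∙ tripled-quartic ⊹ ∙ f))))
      where
      s≉0 : t + integer (+ 1) ≉ 0#
      s≉0 = quartic⇒+1≉0 f

  -- Case analysis of the addition law, and the points of order 5.

  module Addition (k : K.Carrier) where
    open Curve k

    scaled-onCurve : ∀ {x y t} → x ^ 3 ≈ t * ι k → y ^ 2 ≈ (t + integer (+ 1)) * ι k → OnCurve x y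
    scaled-onCurve {x} {y} {t} X Y = by
      (solve 4 (λ c x y t → y :^ 2 :- (x :^ 3 :+ c)
        := ⟨ 1 ⟩ :* (y :^ 2 :- (t :+ ⟨ 1 ⟩) :* c) :+ (:- ⟨ 1 ⟩) :* (x :^ 3 :- t :* c))
        refl (ι k) x y t)
      (· Y ⊹ · X)

    x∈K⟮E⟯ : ∀ {n x y} (p : OnCurve x y) → affine x y p ∈ E[ n ] → x ∈ K⟮E[ n ]⟯
    x∈K⟮E⟯ p torsion = gen (affine _ _ p , torsion , inj₁ refl)

    y∈K⟮E⟯ : ∀ {n x y} (p : OnCurve x y) → affine x y p ∈ E[ n ] → y ∈ K⟮E[ n ]⟯
    y∈K⟮E⟯ p torsion = gen (affine _ _ p , torsion , inj₂ refl)

    -- Slopes enter through their defining equations instead of inverses, so that iterated sums can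
    -- be analysed by pattern matching.
    data IsSum (x y : Carrier) : Point → Point → Set (c′ ⊔ ℓ₁′) where
      unit : ∀ {p} → IsSum x y 𝒪 (affine x y p)
      chord : ∀ {x′ y′ p′} m {p} → x ≉ x′ → m * (x - x′) ≈ y - y′ →
        IsSum x y (affine x′ y′ p′) (affine (thirdX m x x′) (thirdY m x x′ y) p)
      tangent : ∀ {x′ y′ p′} m {p} → x ≈ x′ → y ≈ y′ → y ≉ 0# →
        m * (integer (+ 2) * y) ≈ integer (+ 3) * x ^ 2 →
        IsSum x y (affine x′ y′ p′) (affine (thirdX m x x′) (thirdY m x x′ y) p)
      opposite : ∀ {x′ y′ p′} → x ≈ x′ → y ≈ - y′ → IsSum x y (affine x′ y′ p′) 𝒪

    equal-y : ∀ {x y x′ y′} → OnCurve x y → OnCurve x′ y′ → x ≈ x′ → y ≉ - y′ → y ≈ y′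
    equal-y {x} {y} {x′} {y′} p p′ x≈x′ y≉-y′ = equal (cancelˡ (λ z → y≉-y′ (equal z)) (trans
      (solve 5 (λ x y x′ y′ c → (y :- :- y′) :* (y :- y′)
        := ⟨ 1 ⟩ :* (y :^ 2 :- (x :^ 3 :+ c)) :+ (:- ⟨ 1 ⟩) :* (y′ :^ 2 :- (x′ :^ 3 :+ c))
        :+ (x :^ 2 :+ x :* x′ :+ x′ :^ 2) :* (x :- x′))
        refl x y x′ y′ (ι k))
      (· p ⊹ · p′ ⊹ · x≈x′)))

    tangent-y≉0 : ∀ {y y′} → y ≈ y′ → y ≉ - y′ → y ≉ 0#
    tangent-y≉0 {y} {y′} y≈y′ y≉-y′ y≈0 = y≉-y′ (by
      (solve 2 (λ y y′ → y :- :- y′ := ⟨ 2 ⟩ :* y :+ (:- ⟨ 1 ⟩) :* (y :- y′)) refl y y′)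
      (∙ y≈0 ⊹ · y≈y′))

    chord-slope : ∀ {x x′} (x#x′ : x # x′) y y′ → chordSlope x#x′ y y′ * (x - x′) ≈ y - y′
    chord-slope x#x′ y y′ = trans (*-assoc _ _ _)
      (trans (*-congˡ (proj₁ (proj₂ (#⇒invertible x#x′)))) (*-identityʳ _))

    tangent-slope : ∀ {x y y′} (y#-y′ : y # - y′) → y ≈ y′ →
      tangentSlope x y#-y′ * (integer (+ 2) * y) ≈ integer (+ 3) * x ^ 2
    tangent-slope {x} {y} {y′} y#-y′ y≈y′ = trans (*-assoc _ _ _)
      (trans (*-congˡ (trans (*-congˡ double) (proj₁ (proj₂ (#⇒invertible y#-y′))))) (*-identityʳ _))
      where
      double : integer (+ 2) * y ≈ y - - y′
      double = by (solve 2 (λ y y′ → ⟨ 2 ⟩ :* y :- (y :- :- y′) := ⟨ 1 ⟩ :* (y :- y′)) refl y y′) (· y≈y′)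

    addition : ∀ {x y} p Q → IsSum x y Q (affine x y p +ₚ Q)
    addition p 𝒪 = unit
    addition {x} {y} p (affine x′ y′ p′) with x #? x′ | y #? - y′
    ... | yes x#x′ | _ = chord _ (#⇒≉ x#x′) (chord-slope x#x′ y y′)
    ... | no ¬x#x′ | no ¬y#-y′ = opposite (¬#⇒≈ ¬x#x′) (¬#⇒≈ ¬y#-y′)
    ... | no ¬x#x′ | yes y#-y′ = tangent _ x≈x′ y≈y′ (tangent-y≉0 y≈y′ (#⇒≉ y#-y′)) (tangent-slope y#-y′ y≈y′)
      where
      x≈x′ : x ≈ x′
      x≈x′ = ¬#⇒≈ ¬x#x′
      y≈y′ : y ≈ y′
      y≈y′ = equal-y p p′ x≈x′ (#⇒≉ y#-y′)

    difference-tangent : ∀ m x → x - thirdX m x x ≈ integer (+ 3) * x - m ^ 2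
    difference-tangent m x = solve 2 (λ m x → x :- (m :^ 2 :- x :- x) := ⟨ 3 ⟩ :* x :- m :^ 2) refl m x

    difference-chord : ∀ m x x′ → x - thirdX m x x′ ≈ integer (+ 3) * x - (x - x′) - m ^ 2
    difference-chord m x x′ =
      solve 3 (λ m x x′ → x :- (m :^ 2 :- x :- x′) := ⟨ 3 ⟩ :* x :- (x :- x′) :- m :^ 2) refl m x x′

    slope-sum : ∀ {m m′ u y} → m′ * u ≈ y - (m * u - y) → (m + m′) * u ≈ integer (+ 2) * y
    slope-sum {m} {m′} {u} {y} h = by
      (solve 4 (λ m m′ u y → (m :+ m′) :* u :- ⟨ 2 ⟩ :* y := ⟨ 1 ⟩ :* (m′ :* u :- (y :- (m :* u :- y))))
        refl m m′ u y)
      (· h)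

    reflected : ∀ {m x x′ y} → x ≈ x′ → y ≈ - (m * (x - x′) - y)
    reflected {m} {x} {x′} {y} x≈x′ = by
      (solve 4 (λ m x x′ y → y :- :- (m :* (x :- x′) :- y) := m :* (x :- x′)) refl m x x′ y)
      (· x≈x′)

    -- A sum lying over x has y-coordinate -y, so it can agree with P only if y = 0.
    not-doubled : ∀ {m x x′ y} → x ≈ x′ → y ≈ m * (x - x′) - y → y ≈ 0#
    not-doubled x≈x′ y≈y′ = self-opposite (trans (reflected x≈x′) (-‿cong (sym y≈y′)))

    slope²⇔ : ∀ {m x x′} → (x ≈ thirdX m x x′ → m ^ 2 ≈ integer (+ 3) * x - (x - x′))
                         × (m ^ 2 ≈ integer (+ 3) * x - (x - x′) → x ≈ thirdX m x x′)
    slope²⇔ {m} {x} {x′} =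
      (λ h → by (solve 3 (λ m x x′ → m :^ 2 :- (⟨ 3 ⟩ :* x :- (x :- x′))
        := (:- ⟨ 1 ⟩) :* (x :- (m :^ 2 :- x :- x′))) refl m x x′) (· h)) ,
      (λ h → by (solve 3 (λ m x x′ → x :- (m :^ 2 :- x :- x′)
        := (:- ⟨ 1 ⟩) :* (m :^ 2 :- (⟨ 3 ⟩ :* x :- (x :- x′)))) refl m x x′) (· h))

    module Torsion {x y t : Carrier} (k≉0 : ι k ≉ 0#) (p : OnCurve x y)
      (X : x ^ 3 ≈ t * ι k) (Y : y ^ 2 ≈ (t + integer (+ 1)) * ι k) where

      private P = affine x y p

      -- `Q`, `R`, `S`, `T` are 2P, 3P, 4P, 5P. The only consistent sequence is tangent, chord,
      -- chord, opposite, and its last sum places 4P over x.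
      sums⇒quartic : ∀ {Q R S T} → IsSum x y P Q → IsSum x y Q R → IsSum x y R S → IsSum x y S T →
        T ≈ₚ 𝒪 → quartic t ≈ 0#
      sums⇒quartic _ _ _ unit ()
      sums⇒quartic _ _ _ (chord _ _ _) ()
      sums⇒quartic _ _ _ (tangent _ _ _ _ _) ()
      sums⇒quartic (chord _ x≉x _) _ _ _ _ = ⊥-elim (x≉x refl)
      sums⇒quartic (opposite _ _) unit (chord _ x≉x _) _ _ = ⊥-elim (x≉x refl)
      sums⇒quartic (opposite _ y≈-y) _ (tangent _ _ _ y≉0 _) _ _ = ⊥-elim (y≉0 (self-opposite y≈-y))
      sums⇒quartic (tangent _ _ _ y≉0 _) _ unit (opposite _ y≈-y) _ = ⊥-elim (y≉0 (self-opposite y≈-y))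
      sums⇒quartic (tangent m₁ _ _ y≉0 M) (tangent m₂ x≈x₂ y≈y₂ _ _) _ _ _ =
        ⊥-elim (y≉0 (not-doubled x≈x₂ y≈y₂))
      sums⇒quartic (tangent _ _ _ y≉0 _) (chord m₂ _ _) (tangent _ x≈x₃ y≈y₃ _ _) _ _ =
        ⊥-elim (y≉0 (not-doubled x≈x₃ y≈y₃))
      sums⇒quartic (tangent m₁ _ _ y≉0 M) (chord m₂ x≉x₂ H₂) (chord m₃ x≉x₃ H₃) (opposite x≈x₄ _) _ =
        tripled⇒quartic (fourfold⇒tripled (slope-sum H₃) (proj₁ slope²⇔ x≈x₄))
        where
        open Slopes y≉0 M (difference-tangent m₁ x) (difference-chord m₂ x _) (slope-sum H₂)
        open Scaled k≉0 X Y M (difference-tangent m₁ x)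

      y≉0 : quartic t ≈ 0# → y ≉ 0#
      y≉0 f y≈0 = quartic⇒+1≉0 f (cancelˡ k≉0 (trans (*-comm _ _) (trans (sym Y)
        (trans (solve 1 (λ y → y :^ 2 := y :* y) refl y) (∙ y≈0)))))

      module _ {m₁ : Carrier} (y≉0 : y ≉ 0#)
        (M : m₁ * (integer (+ 2) * y) ≈ integer (+ 3) * x ^ 2) where

        u≉0 : quartic t ≈ 0# → x - thirdX m₁ x x ≉ 0#
        u≉0 f = tripled⇒u≉0 y≉0 (quartic⇒tripled f)
          where open Scaled k≉0 X Y M (difference-tangent m₁ x)

        v≉0 : ∀ {m₂} → let x₂ = thirdX m₁ x x in
          m₂ * (x - x₂) ≈ y - (m₁ * (x - x₂) - y) → quartic t ≈ 0# → x - thirdX m₂ x x₂ ≉ 0#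
        v≉0 {m₂} H₂ f v≈0 = u≉0 f (trans (tripled⇒u≈v (quartic⇒tripled f)) v≈0)
          where
          open Slopes y≉0 M (difference-tangent m₁ x) (difference-chord m₂ x _) (slope-sum H₂)
          open Scaled k≉0 X Y M (difference-tangent m₁ x)

      -- Since u and v are nonzero, neither 2P nor 3P lies over x, so the first three sums are
      -- tangent, chord, chord. Then 4P lies over x, and 4P = P would give y = 0.
      sums⇐quartic : ∀ {Q R S T} → IsSum x y P Q → IsSum x y Q R → IsSum x y R S → IsSum x y S T →
        quartic t ≈ 0# → T ≈ₚ 𝒪
      sums⇐quartic (chord _ x≉x _) _ _ _ _ = ⊥-elim (x≉x refl)
      sums⇐quartic (opposite _ y≈-y) _ _ _ f = ⊥-elim (y≉0 f (self-opposite y≈-y))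
      sums⇐quartic (tangent m₁ _ _ y≉0 M) (opposite x≈x₂ _) _ _ f =
        ⊥-elim (u≉0 y≉0 M f (difference x≈x₂))
      sums⇐quartic (tangent m₁ _ _ y≉0 M) (tangent _ x≈x₂ _ _ _) _ _ f =
        ⊥-elim (u≉0 y≉0 M f (difference x≈x₂))
      sums⇐quartic (tangent m₁ _ _ y≉0 M) (chord m₂ _ H₂) (opposite x≈x₃ _) _ f =
        ⊥-elim (v≉0 y≉0 M H₂ f (difference x≈x₃))
      sums⇐quartic (tangent m₁ _ _ y≉0 M) (chord m₂ _ H₂) (tangent _ x≈x₃ _ _ _) _ f =
        ⊥-elim (v≉0 y≉0 M H₂ f (difference x≈x₃))
      sums⇐quartic (tangent _ _ _ _ _) (chord _ _ _) (chord _ _ _) (opposite _ _) _ = tt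
      sums⇐quartic (tangent _ _ _ y≉0 _) (chord _ _ _) (chord _ _ _) (tangent _ x≈x₄ y≈y₄ _ _) _ =
        ⊥-elim (y≉0 (not-doubled x≈x₄ y≈y₄))
      sums⇐quartic (tangent m₁ _ _ y≉0 M) (chord m₂ _ H₂) (chord m₃ _ H₃) (chord _ x≉x₄ _) f =
        ⊥-elim (x≉x₄ (proj₂ slope²⇔ (tripled⇒fourfold (slope-sum H₃) (quartic⇒tripled f))))
        where
        open Slopes y≉0 M (difference-tangent m₁ x) (difference-chord m₂ x _) (slope-sum H₂)
        open Scaled k≉0 X Y M (difference-tangent m₁ x)

      E[5]⇒quartic : P ∈ E[ 5 ] → quartic t ≈ 0#
      -- `5 · P` is a nested sum with P always on the left; the innermost P + 𝒪 computes to P, which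
      -- leaves four additions.
      E[5]⇒quartic = sums⇒quartic (addition p _) (addition p _) (addition p _) (addition p _)

      quartic⇒E[5] : quartic t ≈ 0# → P ∈ E[ 5 ]
      quartic⇒E[5] = sums⇐quartic (addition p _) (addition p _) (addition p _) (addition p _)

  -- Generated subfields and the points defined over them.

  generated : ∀ {s t} {S : Pred Carrier s} {T : Pred Carrier t} → S ⊆ K⟮ T ⟯ → K⟮ S ⟯ ⊆ K⟮ T ⟯
  generated S⊆T (base a)    = base a
  generated S⊆T (gen x)     = S⊆T x
  generated S⊆T (add x y)   = add (generated S⊆T x) (generated S⊆T y)
  generated S⊆T (neg x)     = neg (generated S⊆T x)
  generated S⊆T (mul x y)   = mul (generated S⊆T x) (generated S⊆T y)
  generated S⊆T (inv x xy≈1) = inv (generated S⊆T x) xy≈1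
  generated S⊆T (resp x≈y x) = resp x≈y (generated S⊆T x)

  conic⇒quartic : ∀ {q t} → q √5 → conic q t ≈ 0# → quartic t ≈ 0#
  conic⇒quartic {q} {t} h p = trans
    (solve 3 (λ a b f → f := con (+ 1 ℚ./ 5) :* b :* a :+ con (ℤ.- + 1 ℚ./ 5) :* (a :* b :- ⟨ 5 ⟩ :* f))
      refl (conic q t) (conic (- q) t) (quartic t))
    (∙ p ⊹ · quartic-factors t h)

  quotient : ∀ {s} {S : Pred Carrier s} {x y z} →
    x ∈ K⟮ S ⟯ → z ∈ K⟮ S ⟯ → z ≉ 0# → y * z ≈ x → y ∈ K⟮ S ⟯
  quotient {x = x} {y} {z} x∈ z∈ z≉0 yz≈x with reciprocal z≉0
  ... | z⁻¹ , zz⁻¹≈1 = resp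
    (trans (*-congʳ (sym yz≈x)) (trans (*-assoc y z z⁻¹) (trans (*-congˡ zz⁻¹≈1) (*-identityʳ y))))
    (mul x∈ (inv z∈ zz⁻¹≈1))

  module Subfield {s} {S : Pred Carrier s} {k : K.Carrier} (k≉0 : ι k ≉ 0#)
    {w : Carrier} (w∈ : w ∈ K⟮ S ⟯) (Φ₃ : w ^ 2 + w + integer (+ 1) ≈ 0#) where

    private
      L : Pred Carrier _
      L = K⟮ S ⟯

    square : ∀ {x} → x ∈ L → x ^ 2 ∈ L
    -- `x ^ 2` computes to `x * (x * 1#)`, hence the factor from `base`.
    square x∈ = mul x∈ (mul x∈ (resp one (base _)))

    cube : ∀ {x} → x ∈ L → x ^ 3 ∈ L
    cube x∈ = mul x∈ (square x∈)

    HasPoint : Carrier → Set _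
    HasPoint t = ∃[ x ] ∃[ y ] x ∈ L × y ∈ L × x ^ 3 ≈ t * ι k × y ^ 2 ≈ (t + integer (+ 1)) * ι k

    HasPoint-resp : ∀ {t t′} → t ≈ t′ → HasPoint t → HasPoint t′
    HasPoint-resp t≈t′ (x , y , x∈ , y∈ , X , Y) =
      x , y , x∈ , y∈ , trans X (*-congʳ t≈t′) , trans Y (*-congʳ (+-congʳ t≈t′))

    -- (x , y) is sent to √-3 (x , y), up to sign; here √-3 = 2w + 1 and t = x³ / c.
    √-3-isogeny : ∀ {t t′} → t ≉ 0# → integer (+ 27) * t ^ 2 * t′ ≈ - (t + integer (+ 4)) ^ 3 →
      HasPoint t → HasPoint t′
    √-3-isogeny {t} {t′} t≉0 I (x , y , x∈ , y∈ , X , Y) with reciprocal t≉0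
    ... | e , te≈1 =
      rational (ℤ.- + 1 ℚ./ 3) * (t + integer (+ 4)) * e * x ,
      rational (ℤ.- + 1 ℚ./ 9) * (integer (+ 2) * w + integer (+ 1)) * (t - integer (+ 8)) * e * y ,
      mul (mul (mul (base _) (add t∈ (base _))) e∈) x∈ ,
      mul (mul (mul (mul (base _) (add (mul (base _) w∈) (base _))) (add t∈ (neg (base _)))) e∈) y∈ ,
      by
        (solve 5 (λ c x t t′ e → (con (ℤ.- + 1 ℚ./ 3) :* (t :+ ⟨ 4 ⟩) :* e :* x) :^ 3 :- t′ :* c
          := con (ℤ.- + 1 ℚ./ 27) :* (t :+ ⟨ 4 ⟩) :^ 3 :* e :^ 3 :* (x :^ 3 :- t :* c)
          :+ con (ℤ.- + 1 ℚ./ 27) :* e :^ 3 :* t :* c :* (⟨ 27 ⟩ :* t :^ 2 :* t′ :- :- (t :+ ⟨ 4 ⟩) :^ 3)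
          :+ ((t :* e) :^ 2 :+ t :* e :+ ⟨ 1 ⟩) :* t′ :* c :* (t :* e :- ⟨ 1 ⟩))
          refl (ι k) x t t′ e)
        (· X ⊹ · I ⊹ · E) ,
      -- This rests on 27 t² - (t + 4)³ = -(t + 1) (t - 8)² and (2 w + 1)² = -3.
      by
        (solve 6 (λ c y t t′ e w →
          (con (ℤ.- + 1 ℚ./ 9) :* (⟨ 2 ⟩ :* w :+ ⟨ 1 ⟩) :* (t :- ⟨ 8 ⟩) :* e :* y) :^ 2 :- (t′ :+ ⟨ 1 ⟩) :* c
          := con (+ 1 ℚ./ 81) :* (⟨ 2 ⟩ :* w :+ ⟨ 1 ⟩) :^ 2 :* (t :- ⟨ 8 ⟩) :^ 2 :* e :^ 2
            :* (y :^ 2 :- (t :+ ⟨ 1 ⟩) :* c)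
          :+ con (+ 4 ℚ./ 81) :* (t :- ⟨ 8 ⟩) :^ 2 :* e :^ 2 :* (t :+ ⟨ 1 ⟩) :* c :* (w :^ 2 :+ w :+ ⟨ 1 ⟩)
          :+ con (ℤ.- + 1 ℚ./ 27) :* e :^ 2 :* c :* (⟨ 27 ⟩ :* t :^ 2 :* t′ :- :- (t :+ ⟨ 4 ⟩) :^ 3)
          :+ (t :* e :+ ⟨ 1 ⟩) :* (t′ :+ ⟨ 1 ⟩) :* c :* (t :* e :- ⟨ 1 ⟩))
          refl (ι k) y t t′ e w)
        (· Y ⊹ ∙ Φ₃ ⊹ · I ⊹ · E)
      where
      t∈ : t ∈ L
      t∈ = quotient (cube x∈) (base k) k≉0 (sym X)
      e∈ : e ∈ L
      e∈ = inv t∈ te≈1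
      E : t * e ≈ integer (+ 1)
      E = trans te≈1 (sym one)

    HasPoint-next : ∀ {q t} → q √5 → conic q t ≈ 0# → HasPoint t → HasPoint (next q t)
    HasPoint-next h p = √-3-isogeny (quartic⇒≉0 (conic⇒quartic h p)) (next-isogeny h p)

    -- √-3 exchanges the two conics, and applying it twice leads from `t` to the other root of
    -- `conic q`.
    conic-HasPoint : ∀ {q t T} → q √5 → conic q t ≈ 0# → HasPoint t → conic q T ≈ 0# → HasPoint T
    conic-HasPoint h p P p′ =
      [ (λ T≈t → HasPoint-resp (sym T≈t) P)
      , (λ T≈t″ → HasPoint-resp (sym T≈t″)
          (HasPoint-next (-√5 h) (next-conic h p) (HasPoint-next h p P)))
      ]′ (conic-roots h p p′)

    -- A root of `quartic` is a root of one of the conics; a single application of √-3 supplies a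
    -- starting point on the conic of `- q`.
    quartic-HasPoint : ∀ {q t T} → q √5 → conic q t ≈ 0# → HasPoint t → quartic T ≈ 0# → HasPoint T
    quartic-HasPoint {T = T} h p P f =
      [ conic-HasPoint h p P , conic-HasPoint (-√5 h) (next-conic h p) (HasPoint-next h p P) ]′
        (zeroProduct (trans (quartic-factors T h) (∙ f)))

    cubeRoot∈ : ∀ {x x₀} → x₀ ∈ L → x ^ 3 ≈ x₀ ^ 3 → x ∈ L
    cubeRoot∈ {x} {x₀} x₀∈ x³≈x₀³ =
      [ (λ x≈x₀ → resp (sym (equal x≈x₀)) x₀∈)
      , (λ rest →
          [ (λ x≈wx₀ → resp (sym (equal x≈wx₀)) (mul w∈ x₀∈))
          , (λ x≈w²x₀ → resp (sym (equal x≈w²x₀)) (mul (square w∈) x₀∈))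
          ]′ (zeroProduct rest))
      ]′ (zeroProduct (trans
        (solve 3 (λ x x₀ w → (x :- x₀) :* ((x :- w :* x₀) :* (x :- w :^ 2 :* x₀))
          := ⟨ 1 ⟩ :* (x :^ 3 :- x₀ :^ 3)
          :+ (x :- x₀) :* ((w :- ⟨ 1 ⟩) :* x₀ :^ 2 :- x :* x₀) :* (w :^ 2 :+ w :+ ⟨ 1 ⟩))
          refl x x₀ w)
        (· x³≈x₀³ ⊹ ∙ Φ₃)))

    squareRoot∈ : ∀ {y y₀} → y₀ ∈ L → y ^ 2 ≈ y₀ ^ 2 → y ∈ L
    squareRoot∈ {y} {y₀} y₀∈ y²≈y₀² =
      [ (λ y≈y₀ → resp (sym (equal y≈y₀)) y₀∈)
      , (λ y≈-y₀ → resp (sym (equal y≈-y₀)) (neg y₀∈))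
      ]′ (zeroProduct (trans
        (solve 2 (λ y y₀ → (y :- y₀) :* (y :- :- y₀) := ⟨ 1 ⟩ :* (y :^ 2 :- y₀ :^ 2)) refl y y₀)
        (· y²≈y₀²)))

    coordinates∈ : ∀ {x y t} → x ^ 3 ≈ t * ι k → y ^ 2 ≈ (t + integer (+ 1)) * ι k →
      HasPoint t → x ∈ L × y ∈ L
    coordinates∈ X Y (x₀ , y₀ , x₀∈ , y₀∈ , X₀ , Y₀) =
      cubeRoot∈ x₀∈ (trans X (sym X₀)) , squareRoot∈ y₀∈ (trans Y (sym Y₀))

  -- The two inclusions between the fields.

  ι≉0 : ∀ {k} → k K.# K.0# → ι k ≉ 0#
  ι≉0 {k} k#0 ιk≈0 = 1≉0 (trans (sym L.1#-homo) (trans (L.⟦⟧-cong (K.sym inverse-k))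
    (trans (L.*-homo _ _) (trans (*-congˡ (trans (L.⟦⟧-cong k-0≈k) ιk≈0)) (zeroʳ _)))))
    where
    module L = RingMorphisms.IsRingHomomorphism ι-isHom
    inverse-k : K.inverse k#0 K.* (k K.- K.0#) K.≈ K.1#
    inverse-k = proj₁ (proj₂ (K.#⇒invertible k#0))
    k-0≈k : k K.- K.0# K.≈ k
    k-0≈k = Algebra.Apartness.Properties.HeytingCommutativeRing.x-0≈x
      (HeytingField.heytingCommutativeRing K.heytingField) k

  module Generators {k : K.Carrier} (k#0 : k K.# K.0#) {w z r s : Carrier}
    (h₃ : IsPrimitiveRoot 3 w) (h₅ : IsPrimitiveRoot 5 z)
    (R : r ^ 3 ≈ δ₁ w z * ι k) (S : s ^ 2 ≈ (δ₁ w z + 1#) * ι k) where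

    open Curve k
    open Addition k

    private
      δ : Carrier
      δ = δ₁ w z
      c≉0 : ι k ≉ 0#
      c≉0 = ι≉0 k#0
      q√5 : √5-expression z √5
      q√5 = √5-expression-√5 h₅
      S′ : s ^ 2 ≈ (δ + integer (+ 1)) * ι k
      S′ = trans S (*-congʳ (+-congˡ (sym one)))

    quartic-δ₁ : quartic δ ≈ 0#
    quartic-δ₁ = conic⇒quartic q√5 (δ₁-conic h₃ h₅)

    E[5]-point : ∀ {x} (p : OnCurve x s) → x ^ 3 ≈ δ * ι k → affine x s p ∈ E[ 5 ]
    E[5]-point p X = Torsion.quartic⇒E[5] c≉0 p X S′ quartic-δ₁

    E[5]-x∈ : ∀ {x} → x ^ 3 ≈ δ * ι k → x ∈ K⟮E[ 5 ]⟯
    E[5]-x∈ X = x∈K⟮E⟯ {5} _ (E[5]-point (scaled-onCurve X S′) X)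

    wr-cube : (w * r) ^ 3 ≈ δ * ι k
    wr-cube = by
      (solve 4 (λ c w r d → (w :* r) :^ 3 :- d :* c
        := (w :- ⟨ 1 ⟩) :* r :^ 3 :* (w :^ 2 :+ w :+ ⟨ 1 ⟩) :+ ⟨ 1 ⟩ :* (r :^ 3 :- d :* c))
        refl (ι k) w r δ)
      (∙ cyclotomic₃ h₃ ⊹ · R)

    r≉0 : r ≉ 0#
    r≉0 r≈0 = quartic⇒≉0 quartic-δ₁ (cancelˡ c≉0 (trans (*-comm _ _) (trans (sym R)
      (trans (solve 1 (λ r → r :^ 3 := r :^ 2 :* r) refl r) (∙ r≈0)))))

    generators∈K⟮E[5]⟯ : (_∈ₗ (r ∷ w ∷ s ∷ [])) ⊆ K⟮E[ 5 ]⟯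
    generators∈K⟮E[5]⟯ (here x≈r) = resp (sym x≈r) (E[5]-x∈ R)
    generators∈K⟮E[5]⟯ (there (here x≈w)) =
      resp (sym x≈w) (quotient (E[5]-x∈ wr-cube) (E[5]-x∈ R) r≉0 refl)
    generators∈K⟮E[5]⟯ (there (there (here x≈s))) = resp (sym x≈s) (y∈K⟮E⟯ {5} _ (E[5]-point (scaled-onCurve R S′) R))

    L : Pred Carrier _
    L = K⟮ _∈ₗ (r ∷ w ∷ s ∷ []) ⟯

    open Subfield {S = _∈ₗ (r ∷ w ∷ s ∷ [])} c≉0 (gen (there (here refl))) (cyclotomic₃ h₃)

    E[5]-coordinates∈ : ∀ {x y} (p : OnCurve x y) → affine x y p ∈ E[ 5 ] → x ∈ L × y ∈ L
    -- The parameter is t = x³ / c; dividing the equation of the curve by c gives y² / c = t + 1.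
    E[5]-coordinates∈ {x} {y} p torsion = coordinates∈ X Y
      (quartic-HasPoint q√5 (δ₁-conic h₃ h₅)
        (r , s , gen (here refl) , gen (there (there (here refl))) , R , S′)
        (Torsion.E[5]⇒quartic c≉0 p X Y torsion))
      where
      c⁻¹ : Carrier
      c⁻¹ = proj₁ (reciprocal c≉0)
      C : ι k * c⁻¹ ≈ integer (+ 1)
      C = trans (proj₂ (reciprocal c≉0)) (sym one)
      X : x ^ 3 ≈ x ^ 3 * c⁻¹ * ι k
      X = by (solve 3 (λ c c⁻¹ x → x :^ 3 :- x :^ 3 :* c⁻¹ :* c := (:- x :^ 3) :* (c :* c⁻¹ :- ⟨ 1 ⟩))
        refl (ι k) c⁻¹ x) (· C)
      Y : y ^ 2 ≈ (x ^ 3 * c⁻¹ + integer (+ 1)) * ι k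
      Y = by
        (solve 4 (λ c c⁻¹ x y → y :^ 2 :- (x :^ 3 :* c⁻¹ :+ ⟨ 1 ⟩) :* c
          := ⟨ 1 ⟩ :* (y :^ 2 :- (x :^ 3 :+ c)) :+ (:- x :^ 3) :* (c :* c⁻¹ :- ⟨ 1 ⟩))
          refl (ι k) c⁻¹ x y)
        (· p ⊹ · C)

    coordinate∈ : (λ z → ∃[ P ] P ∈ E[ 5 ] × z IsCoordinateOf P) ⊆ L
    coordinate∈ (affine x y p , torsion , inj₁ z≈x) = resp (sym z≈x) (proj₁ (E[5]-coordinates∈ {x} {y} p torsion))
    coordinate∈ (affine x y p , torsion , inj₂ z≈y) = resp (sym z≈y) (proj₂ (E[5]-coordinates∈ {x} {y} p torsion))

theorem5p2 : ∀ {c ℓ₁ ℓ₂ c′ ℓ₁′ ℓ₂′} (K : NumberField c ℓ₁ ℓ₂) (K̄ : AlgebraicClosure (NumberField.asField K) c′ ℓ₁′ ℓ₂′) →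
    let module K = NumberField K
        open AlgebraicClosure K̄
        open OverNumberField K K̄
    in
    (k : K.Carrier) → k K.# K.0# →
    ∀ {ζ₃ ζ₅} → IsPrimitiveRoot 3 ζ₃ → IsPrimitiveRoot 5 ζ₅ →
    ∀ {r s} → r ^ 3 ≈ δ₁ ζ₃ ζ₅ * ι k → s ^ 2 ≈ (δ₁ ζ₃ ζ₅ + 1#) * ι k →
    Curve.K⟮E[_]⟯ k 5 ≐ K⟮ _∈ₗ (r ∷ ζ₃ ∷ s ∷ []) ⟯
theorem5p2 K K̄ k k#0 h₃ h₅ R S =
  generated (coordinate∈ k#0 h₃ h₅ R S) , generated (generators∈K⟮E[5]⟯ k#0 h₃ h₅ R S)
  where
  open FiveDivision K K̄
  open Generators
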